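{- Let $n\ge 1$. For every integer $i$ with $1\le i\le n!$, $$c_{n,i} = \sum_{d\mid i}\left[\binom{n-1}{d-1}\left(\sum_{j\mid \frac{i}{d}} c_{d-1,j}\, c_{n-d,\frac{i}{dj}}\right)\right],$$ where the sums run over positive divisors, and $c_{n,i}=0$ for all other $i$.
   Context: Write $[n]=\{1,\dots,n\}$. A street has parking spots $1,\dots,n$ in order, and cars $c_1,\dots,c_n$ arrive in this order. Given $\alpha=(a_1,\dots,a_n)\in[n]^n$, car $c_i$ drives to its preferred spot $a_i$ and parks there if it is empty; otherwise it continues forward and parks in the first empty spot after $a_i$, if there is one (otherwise it fails to park). The tuple $\alpha$ is a parking function of length $n$ if all $n$ cars park; $PF_n$ is the set of parking functions of length $n$. The map $\varphi:PF_n\to S_n$ sends $\alpha$ to the permutation $s_1s_2\cdots s_n$ (one-line notation), where spot $i$ is occupied by car $c_{s_i}$ after all cars have parked. For $n\ge 0$, the coefficient $c_{n,i}$ is the number of permutations $\sigma\in S_n$ with $|\varphi^{ -1}(\sigma)|=i$. For $n=0$ there is one (empty) permutation and one (empty) parking function, so $c_{0,1}=1$ and $c_{0,i}=0$ for $i\neq 1$. By convention $c_{n,i}=0$ if $n<0$. -}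

module Defs where

open import Data.Fin.Base using (Fin; zero; suc)
import Data.Fin.Properties as Fin
open import Data.Integer.Base using (ℤ; +_; -[1+_])
import Data.Integer.Properties as ℤ
open import Data.List.Base as List using (List; []; _∷_; cartesianProductWith; filter; length; upTo)
open import Data.Maybe.Base as Maybe using (Maybe; just; nothing; _>>=_)
import Data.Maybe.Properties as Maybe
open import Data.Nat.Base using (ℕ; zero; suc; NonZero)
open import Data.Nat.Divisibility using (_∣?_)
open import Data.Nat.ListAction using (sum)
open import Data.Product.Base using (_×_; _,_)
open import Data.Vec.Base as Vec using (Vec; []; _∷_)
import Data.Vec.Properties as Vec
open import Data.Vec.Relation.Unary.AllPairs using (allPairs?)
open import Data.Vec.Relation.Unary.Unique.Propositional using (Unique)
open import Relation.Binary.PropositionalEquality using (_≡_)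
open import Relation.Nullary.Decidable using (Dec; ¬?)
open import Relation.Unary using (Decidable)

-- Spots and cars are numbered from 0, i.e. Fin n stands for [n].

Street : ℕ → ℕ → Set
Street n m = Vec (Maybe (Fin n)) m

-- The first spot of the street is its head; nothing marks an empty spot.
-- Once the car has reached its preferred spot (preference zero) it moves on
-- past occupied spots.  The result is nothing if the car fails to park.
park : ∀ {n m} → Fin n → Fin m → Street n m → Maybe (Street n m)
park c (suc a) (x ∷ s)            = Maybe.map (x ∷_) (park c a s)
park c zero    (nothing ∷ s)      = just (just c ∷ s)
park c zero    (just b ∷ [])      = nothing
park c zero    (just b ∷ s@(_ ∷ _)) = Maybe.map (just b ∷_) (park c zero s)

parkInOrder : ∀ {n m k} → Vec (Fin n × Fin m) k → Street n m → Maybe (Street n m)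
parkInOrder []             s = just s
parkInOrder ((c , a) ∷ cs) s = park c a s >>= parkInOrder cs

-- α is a parking function iff this is not nothing.
parkAll : ∀ {n} → Vec (Fin n) n → Maybe (Street n n)
parkAll {n} α = parkInOrder (Vec.zip (Vec.allFin n) α) (Vec.replicate n nothing)

-- "α ∈ PF_n and φ(α) = σ": every car parks, and in the end each spot i is
-- occupied by car σ_i.
infix 4 _∈φ⁻¹_ _∈φ⁻¹?_

_∈φ⁻¹_ : ∀ {n} → Vec (Fin n) n → Vec (Fin n) n → Set
α ∈φ⁻¹ σ = parkAll α ≡ just (Vec.map just σ)

_∈φ⁻¹?_ : ∀ {n} (α σ : Vec (Fin n) n) → Dec (α ∈φ⁻¹ σ)
α ∈φ⁻¹? σ = Maybe.≡-dec (Vec.≡-dec (Maybe.≡-dec Fin._≟_)) (parkAll α) (just (Vec.map just σ))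

-- Each element of (Fin n)^k, exactly once.
tuples : ∀ n k → List (Vec (Fin n) k)
tuples n zero    = [] ∷ []
tuples n (suc k) = cartesianProductWith _∷_ (List.allFin n) (tuples n k)

unique? : ∀ {n k} → Decidable (Unique {A = Fin n} {k})
unique? = allPairs? (λ x y → ¬? (x Fin.≟ y))

-- Permutations in one-line notation.
permutations : ∀ n → List (Vec (Fin n) n)
permutations n = filter unique? (tuples n n)

fibre : ∀ {n} → Vec (Fin n) n → List (Vec (Fin n) n)
fibre {n} σ = filter (_∈φ⁻¹? σ) (tuples n n)

-- c_{n,i}, with the convention c_{n,i} = 0 for n < 0.
c : ℤ → ℤ → ℕ
c (+ n)      i = length (filter (λ σ → + length (fibre σ) ℤ.≟ i) (permutations n))
c (-[1+ _ ]) i = 0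

-- Sum of f d over the positive divisors d of m, for m > 0 (every such d is
-- suc k with k < m).
∑∣ : ℕ → ((d : ℕ) .{{_ : NonZero d}} → ℕ) → ℕ
∑∣ m f = sum (List.map (λ k → f (suc k)) (filter (λ k → suc k ∣? m) (upTo m)))

{-# OPTIONS --safe #-}

-- A car c ends in its place in the outcome σ exactly when it prefers it or one of
-- the spots of the run of smaller cars ending there, independently of the
-- other cars; so the fibre of σ has ∏ choices c σ elements.  If the last car
-- stands at position d, it has d choices, and it blocks the runs of the cars to
-- its right, so the product factors as d times the products for the two sides.
-- Those depend only on the relative order of the cars, and the set of d - 1
-- cars on the left is arbitrary: hence the binomial coefficient.

module Submission where

open import Defs
open import Data.Integer.Base as ℤ using (ℤ; +_)
open import Data.Nat.Base using (ℕ; _*_; _∸_; _/_; _≤_; _!)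
open import Data.Nat.Combinatorics using (_C_)
open import Data.Nat.Properties using (m*n≢0)
open import Data.Product.Base using (_×_)
open import Relation.Binary.PropositionalEquality using (_≡_)
open import Relation.Nullary.Negation.Core using (¬_)

open import Algebra.Properties.CommutativeSemigroup using (interchange; x∙yz≈y∙xz)
open import Data.Bool.Base using (if_then_else_)
open import Data.Fin.Base as Fin using (Fin; zero; suc; toℕ)
import Data.Fin.Properties as Fin
import Data.Integer.Properties as ℤ
open import Data.List.Base
  using (List; []; _∷_; _++_; [_]; map; filter; length; reverse; tabulate; allFin; upTo; applyUpTo;
         cartesianProductWith)
import Data.List.Membership.DecPropositional as DecMembership
open import Data.List.Membership.Propositional using (_∈_; _∉_)
open import Data.List.Membership.Propositional.Properties using (∈-++⁺ʳ)
open import Data.List.Properties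
  using (map-cong; map-cong-local; map-++; map-∘; map-tabulate; filter-accept; filter-reject; filter-all;
         length-reverse; length-tabulate; unfold-reverse)
open import Data.List.Relation.Binary.Permutation.Propositional
  using (_↭_; ↭-refl; ↭-trans; ↭-prep; ↭-sym; ↭-reflexive; ↭⇒↭ₛ)
open import Data.List.Relation.Binary.Permutation.Propositional.Properties
  using (shift; map⁺; ↭-length; All-resp-↭; ↭-reverse)
open import Data.List.Relation.Binary.Permutation.Setoid.Properties using (Unique-resp-↭)
open import Data.List.Relation.Binary.Sublist.Propositional using (_⊆_; []; _∷_; _∷ʳ_)
open import Data.List.Relation.Binary.Sublist.Propositional.Properties using (All-resp-⊆)
open import Data.List.Relation.Unary.All as All using (All; []; _∷_)
import Data.List.Relation.Unary.All.Properties as All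
open import Data.List.Relation.Unary.AllPairs as AllPairs using (AllPairs; []; _∷_)
import Data.List.Relation.Unary.AllPairs.Properties as AllPairs
open import Data.List.Relation.Unary.Any using (here; there)
open import Data.List.Relation.Unary.Unique.Propositional using (Unique)
open import Data.Maybe.Base as Maybe using (Maybe; just; nothing; _>>=_)
import Data.Maybe.Properties as Maybe
open import Data.Nat.Base hiding (ℕ; _*_; _∸_; _/_; _≤_; _!)
open import Data.Nat.Combinatorics using (nCk+nC[k+1]≡[n+1]C[k+1]; k>n⇒nCk≡0; k![n∸k]!∣n!)
open import Data.Nat.Divisibility using (_∣_; _∣?_; divides; ∣⇒≤; m∣m*n)
open import Data.Nat.DivMod using (m*n/n≡m; m/n/o≡m/[n*o])
open import Data.Nat.ListAction using (sum; product)
open import Data.Nat.ListAction.Properties using (sum-++; sum-↭; product-++; product-↭)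
open import Data.Nat.Properties hiding (m*n≢0)
open import Data.Nat.Solver using (module +-*-Solver)
open import Data.Product.Base using (_,_; ∃-syntax; proj₁; proj₂)
open import Data.Sum.Base using (_⊎_; inj₁; inj₂)
open import Data.Unit.Base using (⊤; tt)
open import Data.Vec.Base as Vec using (Vec; []; _∷_; lookup; _[_]≔_; toList)
import Data.Vec.Properties as Vec
import Data.Vec.Relation.Unary.All as VecAll
import Data.Vec.Relation.Unary.All.Properties as VecAll
import Data.Vec.Relation.Unary.AllPairs as VecAllPairs
import Data.Vec.Relation.Unary.Unique.Propositional as Vec
open import Function.Base using (_∘_; id; case_of_)
open import Level using (0ℓ)
open import Relation.Binary.Core using (Rel)
open import Relation.Binary.Definitions using (tri<; tri≈; tri>; DecidableEquality)
open import Relation.Binary.PropositionalEquality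
  using (_≢_; refl; sym; trans; cong; cong₂; subst; setoid; module ≡-Reasoning)
open import Relation.Nullary.Decidable using (Dec; yes; no; does; _×-dec_; dec-true; dec-false)
open import Relation.Nullary.Negation.Core using (contradiction)
open import Relation.Unary using (Pred; Decidable)

open ≡-Reasoning

private variable
  A B D P Q : Set
  n m k r : ℕ

-- The cars on one side of the last car form an arbitrary set and not an initial segment of `Fin n`,
-- so a recursion on permutations would leave its own domain. No relabelling is constructed: sums
-- are taken over the arrangements of any decreasing list of cars, and two such lists of equal
-- length have equal sums because both unfold to the same expression in smaller lengths. To let this
-- unfolding be repeated, the quantity summed is an arbitrary function `h` of the weight: once the
-- weight p of the left side is fixed, the right side is summed with the function that takes q to h
-- (d * (p * q)). The indicator of a value i enters only at the end. The preferences are independent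
-- because a parked car never moves: if σ is to be the outcome, the street that car c meets is known
-- in advance, with the smaller cars in their places in σ and all other spots empty.

+-interchange : ∀ a b c d → (a + b) + (c + d) ≡ (a + c) + (b + d)
+-interchange = interchange +-commutativeSemigroup

+-swapˡ : ∀ a b c → a + (b + c) ≡ b + (a + c)
+-swapˡ = x∙yz≈y∙xz +-commutativeSemigroup

*-swapˡ : ∀ a b c → a * (b * c) ≡ b * (a * c)
*-swapˡ = x∙yz≈y∙xz *-commutativeSemigroup

-- Sums and indicators

indicator : Dec P → ℕ
indicator P? = if does P? then 1 else 0

indicator-yes : P → (P? : Dec P) → indicator P? ≡ 1
indicator-yes p (yes _) = refl
indicator-yes p (no ¬p) = contradiction p ¬p

indicator-no : ¬ P → (P? : Dec P) → indicator P? ≡ 0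
indicator-no ¬p (yes p) = contradiction p ¬p
indicator-no ¬p (no _)  = refl

indicator-⇔ : (P → Q) → (Q → P) → (P? : Dec P) (Q? : Dec Q) → indicator P? ≡ indicator Q?
indicator-⇔ f g (yes p) Q? = sym (indicator-yes (f p) Q?)
indicator-⇔ f g (no ¬p) Q? = sym (indicator-no (¬p ∘ g) Q?)

indicator-× : (P? : Dec P) (Q? : Dec Q) → indicator (P? ×-dec Q?) ≡ indicator P? * indicator Q?
indicator-× (yes _) Q? = sym (+-identityʳ (indicator Q?))
indicator-× (no _)  Q? = refl

∑ : List A → (A → ℕ) → ℕ
∑ xs f = sum (map f xs)

∑-cong : {f g : A → ℕ} → (∀ x → f x ≡ g x) → (xs : List A) → ∑ xs f ≡ ∑ xs g
∑-cong f≗g xs = cong sum (map-cong f≗g xs)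

∑-*ʳ : (f : A → ℕ) (a : ℕ) (xs : List A) → ∑ xs (λ x → f x * a) ≡ ∑ xs f * a
∑-*ʳ f a []       = refl
∑-*ʳ f a (x ∷ xs) = trans (cong (_+_ (f x * a)) (∑-*ʳ f a xs)) (sym (*-distribʳ-+ a (f x) (∑ xs f)))

∑-*ˡ : (a : ℕ) (f : A → ℕ) (xs : List A) → ∑ xs (λ x → a * f x) ≡ a * ∑ xs f
∑-*ˡ a f []       = sym (*-zeroʳ a)
∑-*ˡ a f (x ∷ xs) = trans (cong (_+_ (a * f x)) (∑-*ˡ a f xs)) (sym (*-distribˡ-+ a (f x) (∑ xs f)))

∑-cartesianProductWith : (_⊕_ : A → B → D) (f : D → ℕ) (xs : List A) (ys : List B) →
  ∑ (cartesianProductWith _⊕_ xs ys) f ≡ ∑ xs (λ x → ∑ ys (λ y → f (x ⊕ y)))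
∑-cartesianProductWith _⊕_ f []       ys = refl
∑-cartesianProductWith _⊕_ f (x ∷ xs) ys = begin
  sum (map f (map (x ⊕_) ys ++ cartesianProductWith _⊕_ xs ys))
    ≡⟨ cong sum (map-++ f (map (x ⊕_) ys) _) ⟩
  sum (map f (map (x ⊕_) ys) ++ map f (cartesianProductWith _⊕_ xs ys))
    ≡⟨ sum-++ (map f (map (x ⊕_) ys)) _ ⟩
  ∑ (map (x ⊕_) ys) f + ∑ (cartesianProductWith _⊕_ xs ys) f
    ≡⟨ cong₂ _+_ (cong sum (sym (map-∘ ys))) (∑-cartesianProductWith _⊕_ f xs ys) ⟩
  ∑ ys (λ y → f (x ⊕ y)) + ∑ xs (λ x′ → ∑ ys (λ y → f (x′ ⊕ y))) ∎

∑-filter : {P : Pred A _} (P? : Decidable P) (f : A → ℕ) (xs : List A) →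
  ∑ (filter P? xs) f ≡ ∑ xs (λ x → indicator (P? x) * f x)
∑-filter P? f []       = refl
∑-filter P? f (x ∷ xs) with P? x
... | yes _ = cong₂ _+_ (sym (+-identityʳ (f x))) (∑-filter P? f xs)
... | no _  = ∑-filter P? f xs

length-filter : {P : Pred A _} (P? : Decidable P) (xs : List A) →
  length (filter P? xs) ≡ ∑ xs (indicator ∘ P?)
length-filter P? []       = refl
length-filter P? (x ∷ xs) with P? x
... | yes _ = cong suc (length-filter P? xs)
... | no _  = length-filter P? xs

∑< : ℕ → (ℕ → ℕ) → ℕ
∑< zero    f = 0
∑< (suc n) f = f 0 + ∑< n (f ∘ suc)

∑<-cong : {f g : ℕ → ℕ} (n : ℕ) → (∀ k → k < n → f k ≡ g k) → ∑< n f ≡ ∑< n g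
∑<-cong zero    f≗g = refl
∑<-cong (suc n) f≗g = cong₂ _+_ (f≗g 0 z<s) (∑<-cong n (λ k k<n → f≗g (suc k) (s<s k<n)))

∑<-+ : (n : ℕ) (f g : ℕ → ℕ) → ∑< n (λ k → f k + g k) ≡ ∑< n f + ∑< n g
∑<-+ zero    f g = refl
∑<-+ (suc n) f g = trans (cong (_+_ (f 0 + g 0)) (∑<-+ n (f ∘ suc) (g ∘ suc))) (+-interchange (f 0) (g 0) _ _)

∑<-zero : (n : ℕ) {f : ℕ → ℕ} → (∀ k → k < n → f k ≡ 0) → ∑< n f ≡ 0
∑<-zero zero    f≡0 = refl
∑<-zero (suc n) f≡0 = cong₂ _+_ (f≡0 0 z<s) (∑<-zero n (λ k k<n → f≡0 (suc k) (s<s k<n)))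

∑<-extend : (n m : ℕ) {f : ℕ → ℕ} → (∀ k → n ≤ k → f k ≡ 0) → ∑< (n + m) f ≡ ∑< n f
∑<-extend zero    m f≡0 = ∑<-zero m (λ k _ → f≡0 k z≤n)
∑<-extend (suc n) m f≡0 = cong (_+_ _) (∑<-extend n m (λ k n≤k → f≡0 (suc k) (s≤s n≤k)))

∑<-single : (n p : ℕ) {f : ℕ → ℕ} → p < n → (∀ k → k ≢ p → f k ≡ 0) → ∑< n f ≡ f p
∑<-single (suc n) zero    {f} _       f≡0 =
  trans (cong (_+_ (f 0)) (∑<-zero n (λ k _ → f≡0 (suc k) λ ()))) (+-identityʳ (f 0))
∑<-single (suc n) (suc p) {f} (s<s p<n) f≡0 =
  cong₂ _+_ (f≡0 0 λ ()) (∑<-single n p p<n (λ k k≢p → f≡0 (suc k) (k≢p ∘ suc-injective)))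

∑-applyUpTo : (n : ℕ) (g f : ℕ → ℕ) → ∑ (applyUpTo g n) f ≡ ∑< n (f ∘ g)
∑-applyUpTo zero    g f = refl
∑-applyUpTo (suc n) g f = cong (_+_ (f (g 0))) (∑-applyUpTo n (g ∘ suc) f)

∑-upTo : (n : ℕ) (f : ℕ → ℕ) → ∑ (upTo n) f ≡ ∑< n f
∑-upTo n = ∑-applyUpTo n id

-- Sums over cuts, splits and arrangements of a list

-- The sums over the cuts w = u ++ v of a word, over the splits of a list into
-- two sublists, over the choices of an entry, and over all arrangements are
-- defined as functionals, so that no lists of such objects are compared.

cutSum : (List A → List A → ℕ) → List A → ℕ
cutSum g []      = g [] []
cutSum g (y ∷ w) = g [] (y ∷ w) + cutSum (λ u → g (y ∷ u)) w

splitSum : List A → (List A → List A → ℕ) → ℕ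
splitSum []      h = h [] []
splitSum (x ∷ S) h = splitSum S (λ A B → h (x ∷ A) B + h A (x ∷ B))

selectSum : (A → List A → ℕ) → List A → ℕ
selectSum g []      = 0
selectSum g (x ∷ S) = g x S + selectSum (λ y S′ → g y (x ∷ S′)) S

arrSum : List A → (List A → ℕ) → ℕ
arrSum []      f = f []
arrSum (x ∷ S) f = arrSum S (cutSum (λ u v → f (u ++ x ∷ v)))

cutSum-cong : {g g′ : List A → List A → ℕ} (w : List A) →
  (∀ u v → u ++ v ≡ w → g u v ≡ g′ u v) → cutSum g w ≡ cutSum g′ w
cutSum-cong []      eq = eq [] [] refl
cutSum-cong (y ∷ w) eq =
  cong₂ _+_ (eq [] (y ∷ w) refl) (cutSum-cong w (λ u v p → eq (y ∷ u) v (cong (y ∷_) p)))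

cutSum-+ : (g g′ : List A → List A → ℕ) (w : List A) →
  cutSum (λ u v → g u v + g′ u v) w ≡ cutSum g w + cutSum g′ w
cutSum-+ g g′ []      = refl
cutSum-+ g g′ (y ∷ w) =
  trans (cong (_+_ (g [] (y ∷ w) + g′ [] (y ∷ w))) (cutSum-+ (λ u → g (y ∷ u)) (λ u → g′ (y ∷ u)) w))
        (+-interchange (g [] (y ∷ w)) _ _ _)

cutSum-0 : (w : List A) → cutSum (λ _ _ → 0) w ≡ 0
cutSum-0 []      = refl
cutSum-0 (y ∷ w) = cutSum-0 w

-- The inserted `x` lies on one side of the cut. So a place for `x` in `w` followed by a cut amounts
-- to a cut of `w` followed by a place for `x` in one of the parts; `x` next to the cut counts twice
-- either way.
cutSum-insert-cut : (x : A) (g : List A → List A → ℕ) (w : List A) →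
  cutSum (λ u v → cutSum g (u ++ x ∷ v)) w ≡
  cutSum (λ u v → cutSum (λ u₁ u₂ → g (u₁ ++ x ∷ u₂) v) u + cutSum (λ v₁ v₂ → g u (v₁ ++ x ∷ v₂)) v) w
cutSum-insert-cut x g []      = +-comm (g [] [ x ]) (g [ x ] [])
cutSum-insert-cut x g (y ∷ w) = begin
  (a + (b + S₁)) + cutSum (λ u v → g [] (y ∷ u ++ x ∷ v) + cutSum (λ u₁ → g (y ∷ u₁)) (u ++ x ∷ v)) w
    ≡⟨ cong (_+_ (a + (b + S₁))) (cutSum-+ _ _ w) ⟩
  (a + (b + S₁)) + (S₂ + cutSum (λ u v → cutSum (λ u₁ → g (y ∷ u₁)) (u ++ x ∷ v)) w)
    ≡⟨ cong (λ s → (a + (b + S₁)) + (S₂ + s)) (cutSum-insert-cut x (λ u → g (y ∷ u)) w) ⟩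
  (a + (b + S₁)) + (S₂ + S₃)
    ≡⟨ solve 5 (λ a b S₁ S₂ S₃ →
         (a :+ (b :+ S₁)) :+ (S₂ :+ S₃) := (b :+ (a :+ S₂)) :+ (S₁ :+ S₃)) refl a b S₁ S₂ S₃ ⟩
  (b + (a + S₂)) + (S₁ + S₃)
    ≡⟨ cong (_+_ (b + (a + S₂))) (sym (cutSum-+ _ _ w)) ⟩
  (b + (a + S₂)) + cutSum (λ u v → g (x ∷ y ∷ u) v + (cutSum (λ u₁ u₂ → g (y ∷ u₁ ++ x ∷ u₂) v) u +
                                                   cutSum (λ v₁ v₂ → g (y ∷ u) (v₁ ++ x ∷ v₂)) v)) w
    ≡⟨ cong (_+_ (b + (a + S₂))) (cutSum-cong w (λ u v _ → sym (+-assoc (g (x ∷ y ∷ u) v) _ _))) ⟩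
  (b + (a + S₂)) + cutSum (λ u v → g (x ∷ y ∷ u) v + cutSum (λ u₁ u₂ → g (y ∷ u₁ ++ x ∷ u₂) v) u +
                                                   cutSum (λ v₁ v₂ → g (y ∷ u) (v₁ ++ x ∷ v₂)) v) w ∎
  where
  open +-*-Solver
  a  = g [] (x ∷ y ∷ w)
  b  = g [ x ] (y ∷ w)
  S₁ = cutSum (λ u v → g (x ∷ y ∷ u) v) w
  S₂ = cutSum (λ u v → g [] (y ∷ u ++ x ∷ v)) w
  S₃ = cutSum (λ u v → cutSum (λ u₁ u₂ → g (y ∷ u₁ ++ x ∷ u₂) v) u +
                       cutSum (λ v₁ v₂ → g (y ∷ u) (v₁ ++ x ∷ v₂)) v) w

arrSum-cong : {f g : List A → ℕ} (S : List A) → (∀ w → w ↭ S → f w ≡ g w) → arrSum S f ≡ arrSum S g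
arrSum-cong []      f≗g = f≗g [] ↭-refl
arrSum-cong (x ∷ S) f≗g = arrSum-cong S λ w w↭S → cutSum-cong w λ where
  u v refl → f≗g (u ++ x ∷ v) (↭-trans (shift x u v) (↭-prep x w↭S))

arrSum-+ : (S : List A) (f g : List A → ℕ) → arrSum S (λ w → f w + g w) ≡ arrSum S f + arrSum S g
arrSum-+ []      f g = refl
arrSum-+ (x ∷ S) f g = trans (arrSum-cong S (λ w _ → cutSum-+ _ _ w)) (arrSum-+ S _ _)

arrSum-0 : (S : List A) → arrSum S (λ _ → 0) ≡ 0
arrSum-0 []      = refl
arrSum-0 (x ∷ S) = trans (arrSum-cong S (λ w _ → cutSum-0 w)) (arrSum-0 S)

arrSum-*ˡ : (S : List A) (a : ℕ) (f : List A → ℕ) → arrSum S (λ w → a * f w) ≡ a * arrSum S f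
arrSum-*ˡ S zero    f = arrSum-0 S
arrSum-*ˡ S (suc a) f = trans (arrSum-+ S f _) (cong (_+_ (arrSum S f)) (arrSum-*ˡ S a f))

arrSum-∑< : (S : List A) (n : ℕ) (f : ℕ → List A → ℕ) →
  arrSum S (λ w → ∑< n (λ k → f k w)) ≡ ∑< n (λ k → arrSum S (f k))
arrSum-∑< S zero    f = arrSum-0 S
arrSum-∑< S (suc n) f = trans (arrSum-+ S (f 0) _) (cong (_+_ (arrSum S (f 0))) (arrSum-∑< S n (f ∘ suc)))

arrSum-cutSum-swap : (S : List A) (g : List B → List B → List A → ℕ) (u : List B) →
  arrSum S (λ v → cutSum (λ u₁ u₂ → g u₁ u₂ v) u) ≡ cutSum (λ u₁ u₂ → arrSum S (g u₁ u₂)) u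
arrSum-cutSum-swap S g []      = refl
arrSum-cutSum-swap S g (y ∷ u) =
  trans (arrSum-+ S _ _) (cong (_+_ (arrSum S (g [] (y ∷ u)))) (arrSum-cutSum-swap S (λ u₁ → g (y ∷ u₁)) u))

splitSum-cong : {h h′ : List A → List A → ℕ} (S : List A) →
  (∀ A B → A ⊆ S → B ⊆ S → length A + length B ≡ length S → h A B ≡ h′ A B) →
  splitSum S h ≡ splitSum S h′
splitSum-cong []      eq = eq [] [] [] [] refl
splitSum-cong (x ∷ S) eq = splitSum-cong S λ A B A⊆S B⊆S |A|+|B|≡|S| →
  cong₂ _+_ (eq (x ∷ A) B (refl ∷ A⊆S) (x ∷ʳ B⊆S) (cong suc |A|+|B|≡|S|))
            (eq A (x ∷ B) (x ∷ʳ A⊆S) (refl ∷ B⊆S) (trans (+-suc (length A) (length B)) (cong suc |A|+|B|≡|S|)))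

-- Inserting x into a word and then cutting it puts x into one of the two parts.
arrSum-cutSum : (S : List A) (g : List A → List A → ℕ) →
  arrSum S (cutSum g) ≡ splitSum S (λ A B → arrSum A (λ u → arrSum B (g u)))
arrSum-cutSum []      g = refl
arrSum-cutSum (x ∷ S) g = begin
  arrSum S (cutSum (λ u v → cutSum g (u ++ x ∷ v)))
    ≡⟨ arrSum-cong S (λ w _ → cutSum-insert-cut x g w) ⟩
  arrSum S (cutSum (λ u v → cutSum (λ u₁ u₂ → g (u₁ ++ x ∷ u₂) v) u + cutSum (λ v₁ v₂ → g u (v₁ ++ x ∷ v₂)) v))
    ≡⟨ arrSum-cutSum S _ ⟩
  splitSum S (λ A B → arrSum A (λ u → arrSum B (λ v →
    cutSum (λ u₁ u₂ → g (u₁ ++ x ∷ u₂) v) u + cutSum (λ v₁ v₂ → g u (v₁ ++ x ∷ v₂)) v)))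
    ≡⟨ splitSum-cong S (λ A B _ _ _ → trans
         (arrSum-cong A λ u _ → trans (arrSum-+ B _ _)
           (cong (_+ arrSum (x ∷ B) (g u)) (arrSum-cutSum-swap B (λ u₁ u₂ → g (u₁ ++ x ∷ u₂)) u)))
         (arrSum-+ A _ _)) ⟩
  splitSum (x ∷ S) (λ A B → arrSum A (λ u → arrSum B (g u))) ∎

selectSum-cong : {g g′ : A → List A → ℕ} (S : List A) →
  (∀ y S′ → length S ≡ suc (length S′) → g y S′ ≡ g′ y S′) → selectSum g S ≡ selectSum g′ S
selectSum-cong []      eq = refl
selectSum-cong (x ∷ S) eq =
  cong₂ _+_ (eq x S refl) (selectSum-cong S (λ y S′ p → eq y (x ∷ S′) (cong suc p)))

-- Either `x` comes first, or the first entry is chosen from `S` and `x` is inserted behind it. This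
-- trades insertion, which suits the recursion on the last car, for a choice of the first entry,
-- which is how `tuples` builds words.
arrSum-select : (x : A) (S : List A) (f : List A → ℕ) →
  arrSum (x ∷ S) f ≡ selectSum (λ y S′ → arrSum S′ (λ w → f (y ∷ w))) (x ∷ S)
arrSum-select x S f = begin
  arrSum S (cutSum (λ u v → f (u ++ x ∷ v)))
    ≡⟨ arrSum-cong S (λ { [] _ → sym (+-identityʳ (f [ x ])) ; (y ∷ w) _ → refl }) ⟩
  arrSum S (λ w → f (x ∷ w) + later w)
    ≡⟨ arrSum-+ S _ _ ⟩
  arrSum S (λ w → f (x ∷ w)) + arrSum S later
    ≡⟨ cong (_+_ (arrSum S (λ w → f (x ∷ w)))) (arrSum-later S) ⟩
  selectSum (λ y S′ → arrSum S′ (λ w → f (y ∷ w))) (x ∷ S) ∎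
  where
  -- The insertions of `x` behind the first entry; the empty word allows none.
  later : List _ → ℕ
  later []      = 0
  later (y ∷ w) = cutSum (λ u v → f (y ∷ u ++ x ∷ v)) w
  arrSum-later : ∀ S → arrSum S later ≡ selectSum (λ y S′ → arrSum (x ∷ S′) (λ w → f (y ∷ w))) S
  arrSum-later []       = refl
  -- `later (y ∷ w)` is itself a sum over insertions of `x`, so the right side obtained for the
  -- shorter list already runs over arrangements of `x ∷ S′`.
  arrSum-later (x′ ∷ S) = arrSum-select x′ S later

-- Putting the head on either side raises one of the two lengths, and the two contributions combine
-- by Pascal's rule. This is where the binomial coefficient arises.
splitSum-length : (S : List A) (G : ℕ → ℕ → ℕ) →
  splitSum S (λ A B → G (length A) (length B)) ≡
  ∑< (suc (length S)) (λ k → (length S C k) * G k (length S ∸ k))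
splitSum-length []      G = sym (trans (+-identityʳ _) (+-identityʳ _))
splitSum-length (x ∷ S) G = begin
  splitSum S (λ A B → G (suc (length A)) (length B) + G (length A) (suc (length B)))
    ≡⟨ splitSum-length S (λ a b → G (suc a) b + G a (suc b)) ⟩
  ∑< (suc s) (λ k → (s C k) * (G (suc k) (s ∸ k) + G k (suc (s ∸ k))))
    ≡⟨ ∑<-cong (suc s) (λ k _ → *-distribˡ-+ (s C k) (G (suc k) (s ∸ k)) (G k (suc (s ∸ k)))) ⟩
  ∑< (suc s) (λ k → (s C k) * G (suc k) (s ∸ k) + (s C k) * G k (suc (s ∸ k)))
    ≡⟨ ∑<-+ (suc s) (λ k → (s C k) * G (suc k) (s ∸ k)) (λ k → (s C k) * G k (suc (s ∸ k))) ⟩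
  Σ₁ + ∑< (suc s) (λ k → (s C k) * G k (suc (s ∸ k)))
    -- A vanishing term for `k = suc s` is appended, so that splitting off `k = 0` leaves a second
    -- sum over the same range as `Σ₁`.
    ≡⟨ cong (_+_ Σ₁) (∑<-extend (suc s) 1 (λ k s<k → cong (_* G k (suc (s ∸ k))) (k>n⇒nCk≡0 s<k))) ⟨
  Σ₁ + ∑< (suc s + 1) (λ k → (s C k) * G k (suc (s ∸ k)))
    ≡⟨ cong (λ t → Σ₁ + ∑< t (λ k → (s C k) * G k (suc (s ∸ k)))) (+-comm (suc s) 1) ⟩
  Σ₁ + (1 * G 0 (suc s) + ∑< (suc s) (λ k → (s C suc k) * G (suc k) (suc (s ∸ suc k))))
    ≡⟨ +-swapˡ Σ₁ (1 * G 0 (suc s)) _ ⟩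
  1 * G 0 (suc s) + (Σ₁ + ∑< (suc s) (λ k → (s C suc k) * G (suc k) (suc (s ∸ suc k))))
    ≡⟨ cong (_+_ (1 * G 0 (suc s))) (sym (∑<-+ (suc s) (λ k → (s C k) * G (suc k) (s ∸ k))
         (λ k → (s C suc k) * G (suc k) (suc (s ∸ suc k))))) ⟩
  1 * G 0 (suc s) + ∑< (suc s) (λ k → (s C k) * G (suc k) (s ∸ k) + (s C suc k) * G (suc k) (suc (s ∸ suc k)))
    ≡⟨ cong (_+_ (1 * G 0 (suc s))) (∑<-cong (suc s) λ k k≤s → pascal k (m≤n⇒m<n∨m≡n (≤-pred k≤s))) ⟩
  1 * G 0 (suc s) + ∑< (suc s) (λ k → (suc s C suc k) * G (suc k) (s ∸ k)) ∎
  where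
  s  = length S
  Σ₁ = ∑< (suc s) (λ k → (s C k) * G (suc k) (s ∸ k))
  -- For `k < s` the last arguments agree. At `k = s` truncated subtraction makes them 1 and 0, but
  -- there the binomial coefficient is 0.
  shift-suc : ∀ k → k < s ⊎ k ≡ s →
    (s C suc k) * G (suc k) (suc (s ∸ suc k)) ≡ (s C suc k) * G (suc k) (s ∸ k)
  shift-suc k (inj₁ k<s)  = cong (λ t → (s C suc k) * G (suc k) t) (sym (+-∸-assoc 1 k<s))
  shift-suc k (inj₂ refl) rewrite k>n⇒nCk≡0 (n<1+n s) = refl
  pascal : ∀ k → k < s ⊎ k ≡ s →
    (s C k) * G (suc k) (s ∸ k) + (s C suc k) * G (suc k) (suc (s ∸ suc k)) ≡
    (suc s C suc k) * G (suc k) (s ∸ k)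
  pascal k k≤s = begin
    (s C k) * g + (s C suc k) * G (suc k) (suc (s ∸ suc k)) ≡⟨ cong (_+_ ((s C k) * g)) (shift-suc k k≤s) ⟩
    (s C k) * g + (s C suc k) * g                           ≡⟨ *-distribʳ-+ g (s C k) (s C suc k) ⟨
    (s C k + s C suc k) * g                                 ≡⟨ cong (_* g) (nCk+nC[k+1]≡[n+1]C[k+1] s k) ⟩
    (suc s C suc k) * g                                     ∎
    where g = G (suc k) (s ∸ k)

-- The weight of an outcome

-- Whether a car c starting at the first spot of w drives past smaller cars
-- only until it meets its own place in w.
reach : Fin n → List (Fin n) → ℕ
reach c []      = 0
reach c (x ∷ w) with Fin.<-cmp x c
... | tri< _ _ _ = reach c w
... | tri≈ _ _ _ = 1
... | tri> _ _ _ = 0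

-- The number of preferences that bring car c to its place in the outcome w.
choices : Fin n → List (Fin n) → ℕ
choices c []      = 0
choices c (x ∷ w) = reach c (x ∷ w) + choices c w

weight : List (Fin n) → ℕ
weight w = product (map (λ c → choices c w) w)

reach-∉ : (c : Fin n) (w : List (Fin n)) → c ∉ w → reach c w ≡ 0
reach-∉ c []      c∉w = refl
reach-∉ c (x ∷ w) c∉w with Fin.<-cmp x c
... | tri< _ _ _ = reach-∉ c w (c∉w ∘ there)
... | tri≈ _ x≡c _ = contradiction (here (sym x≡c)) c∉w
... | tri> _ _ _ = refl

choices-∉ : (c : Fin n) (w : List (Fin n)) → c ∉ w → choices c w ≡ 0
choices-∉ c []      c∉w = refl
choices-∉ c (x ∷ w) c∉w = cong₂ _+_ (reach-∉ c (x ∷ w) c∉w) (choices-∉ c w (c∉w ∘ there))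

reach-++ : (c : Fin n) (w z : List (Fin n)) → c ∉ z → reach c (w ++ z) ≡ reach c w
reach-++ c []      z c∉z = reach-∉ c z c∉z
reach-++ c (x ∷ w) z c∉z with Fin.<-cmp x c
... | tri< _ _ _ = reach-++ c w z c∉z
... | tri≈ _ _ _ = refl
... | tri> _ _ _ = refl

choices-++ : (c : Fin n) (w z : List (Fin n)) → c ∉ z → choices c (w ++ z) ≡ choices c w
choices-++ c []      z c∉z = choices-∉ c z c∉z
choices-++ c (x ∷ w) z c∉z = cong₂ _+_ (reach-++ c (x ∷ w) z c∉z) (choices-++ c w z c∉z)

module _ {m : Fin n} {v : List (Fin n)} where

  -- The place of `c` is not in `u`, so `c` could reach it only by driving past the larger car `m`.
  reach-blocked : {c : Fin n} (u : List (Fin n)) → c Fin.< m → c ∉ u → reach c (u ++ m ∷ v) ≡ 0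
  reach-blocked {c} []      c<m c∉u with Fin.<-cmp m c
  ... | tri< m<c _ _ = contradiction c<m (<-asym m<c)
  ... | tri≈ _ refl _ = contradiction c<m (<-irrefl refl)
  ... | tri> _ _ _ = refl
  reach-blocked {c} (x ∷ u) c<m c∉u with Fin.<-cmp x c
  ... | tri< _ _ _ = reach-blocked u c<m (c∉u ∘ there)
  ... | tri≈ _ x≡c _ = contradiction (here (sym x≡c)) c∉u
  ... | tri> _ _ _ = refl

  choices-blocked : {c : Fin n} (u : List (Fin n)) → c Fin.< m → c ∉ u → choices c (u ++ m ∷ v) ≡ choices c v
  choices-blocked []      c<m c∉u = cong (_+ _) (reach-blocked [] c<m c∉u)
  choices-blocked (x ∷ u) c<m c∉u = cong₂ _+_ (reach-blocked (x ∷ u) c<m c∉u) (choices-blocked u c<m (c∉u ∘ there))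

  reach-max : (u : List (Fin n)) → All (Fin._< m) u → reach m (u ++ m ∷ v) ≡ 1
  reach-max []      []          with Fin.<-cmp m m
  ... | tri< m<m _ _ = contradiction m<m (<-irrefl refl)
  ... | tri≈ _ _ _ = refl
  ... | tri> _ _ m<m = contradiction m<m (<-irrefl refl)
  reach-max (x ∷ u) (x<m ∷ u<m) with Fin.<-cmp x m
  ... | tri< _ _ _ = reach-max u u<m
  ... | tri≈ x≮m _ _ = contradiction x<m x≮m
  ... | tri> x≮m _ _ = contradiction x<m x≮m

  choices-max : (u : List (Fin n)) → All (Fin._< m) u → m ∉ v → choices m (u ++ m ∷ v) ≡ suc (length u)
  choices-max []      []          m∉v = cong₂ _+_ (reach-max [] []) (choices-∉ m v m∉v)
  choices-max (x ∷ u) (x<m ∷ u<m) m∉v = cong₂ _+_ (reach-max (x ∷ u) (x<m ∷ u<m)) (choices-max u u<m m∉v)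

∉-bounded : {m : Fin n} {w : List (Fin n)} → All (Fin._< m) w → m ∉ w
∉-bounded w<m m∈w = <-irrefl refl (All.lookup w<m m∈w)

Unique-++-disjoint : {A : Set} (u : List A) {v : List A} → Unique (u ++ v) → ∀ {x} → x ∈ u → x ∉ v
Unique-++-disjoint (x ∷ u) (x≢ ∷ _)  (here refl) x∈v = All.lookup x≢ (∈-++⁺ʳ u x∈v) refl
Unique-++-disjoint (y ∷ u) (_ ∷ u!v) (there x∈u) x∈v = Unique-++-disjoint u u!v x∈u x∈v

weight-max : {m : Fin n} (u v : List (Fin n)) → All (Fin._< m) (u ++ v) → Unique (u ++ v) →
  weight (u ++ m ∷ v) ≡ suc (length u) * (weight u * weight v)
weight-max {m = m} u v uv<m uv! = begin
  product (map φ (u ++ m ∷ v))                      ≡⟨ cong product (map-++ φ u (m ∷ v)) ⟩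
  product (map φ u ++ φ m ∷ map φ v)                ≡⟨ product-++ (map φ u) (φ m ∷ map φ v) ⟩
  product (map φ u) * (φ m * product (map φ v))
    ≡⟨ cong₂ _*_ (cong product (map-cong-local (All.tabulate left)))
         (cong₂ _*_ (choices-max u u<m (∉-bounded v<m)) (cong product (map-cong-local (All.tabulate right)))) ⟩
  weight u * (suc (length u) * weight v)            ≡⟨ *-swapˡ (weight u) (suc (length u)) (weight v) ⟩
  suc (length u) * (weight u * weight v)            ∎
  where
  φ   = λ c → choices c (u ++ m ∷ v)
  u<m = All.++⁻ˡ u uv<m
  v<m = All.++⁻ʳ u uv<m
  left : ∀ {x} → x ∈ u → φ x ≡ choices x u
  left x∈u = choices-++ _ u (m ∷ v) λ where
    (here refl) → ∉-bounded u<m x∈u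
    (there x∈v) → Unique-++-disjoint u uv! x∈u x∈v
  right : ∀ {x} → x ∈ v → φ x ≡ choices x v
  right x∈v = choices-blocked u (All.lookup v<m x∈v) (λ x∈u → Unique-++-disjoint u uv! x∈u x∈v)

-- Recursion on the last car, for sums over all outcomes

Decreasing : List (Fin n) → Set
Decreasing = AllPairs Fin._>_

AllPairs-resp-⊆ : {A : Set} {R : Rel A 0ℓ} {xs ys : List A} → xs ⊆ ys → AllPairs R ys → AllPairs R xs
AllPairs-resp-⊆ []          []       = []
AllPairs-resp-⊆ (_ ∷ʳ p)    (_ ∷ rs) = AllPairs-resp-⊆ p rs
AllPairs-resp-⊆ (refl ∷ p)  (r ∷ rs) = All-resp-⊆ p r ∷ AllPairs-resp-⊆ p rs

AllPairs-reverse : {A : Set} {R : Rel A 0ℓ} (xs : List A) → AllPairs R xs → AllPairs (λ x y → R y x) (reverse xs)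
AllPairs-reverse []       []       = []
AllPairs-reverse (x ∷ xs) (r ∷ rs) = subst (AllPairs _) (sym (unfold-reverse x xs))
  (AllPairs.++⁺ (AllPairs-reverse xs rs) ([] ∷ []) (All.map (_∷ []) (All-resp-↭ (↭-sym (↭-reverse xs)) r)))

Decreasing⇒Unique : {S : List (Fin n)} → Decreasing S → Unique S
Decreasing⇒Unique = AllPairs.map λ x>y x≡y → <-irrefl (cong Fin.toℕ (sym x≡y)) x>y

-- The head of a decreasing list is the last car to arrive, and inserting it cuts the word of the
-- other cars at that place. Hence `weight-max` factors every term, and the cut becomes a split of
-- `S`.
arrSum-weight-∷ : {m : Fin n} (S : List (Fin n)) → Decreasing (m ∷ S) → (h : ℕ → ℕ) →
  arrSum (m ∷ S) (h ∘ weight) ≡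
  splitSum S (λ A B → arrSum A (λ u → arrSum B (λ v → h (suc (length A) * (weight u * weight v)))))
arrSum-weight-∷ {m = m} S (S<m ∷ S>) h = begin
  arrSum S (cutSum (λ u v → h (weight (u ++ m ∷ v))))
    ≡⟨ arrSum-cong S (λ w w↭S → cutSum-cong w λ { u v refl → cong h (weight-max u v
         (All-resp-↭ (↭-sym w↭S) S<m)
         (Unique-resp-↭ (setoid _) (↭⇒↭ₛ (↭-sym w↭S)) (Decreasing⇒Unique S>))) }) ⟩
  arrSum S (cutSum (λ u v → h (suc (length u) * (weight u * weight v))))
    ≡⟨ arrSum-cutSum S _ ⟩
  splitSum S (λ A B → arrSum A (λ u → arrSum B (λ v → h (suc (length u) * (weight u * weight v)))))
    ≡⟨ splitSum-cong S (λ A B _ _ _ → arrSum-cong A (λ u u↭A →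
         cong (λ l → arrSum B (λ v → h (suc l * (weight u * weight v)))) (↭-length u↭A))) ⟩
  splitSum S (λ A B → arrSum A (λ u → arrSum B (λ v → h (suc (length A) * (weight u * weight v))))) ∎

-- Reversed because `arrSum` inserts the head last, and the car inserted last has to be the largest.
countdown : ∀ n → List (Fin n)
countdown n = reverse (allFin n)

countdown-decreasing : ∀ n → Decreasing (countdown n)
countdown-decreasing n = AllPairs-reverse (allFin n) (AllPairs.tabulate⁺-< id)

length-countdown : ∀ n → length (countdown n) ≡ n
length-countdown n = trans (length-reverse (allFin n)) (length-tabulate id)

weightSum : ℕ → (ℕ → ℕ) → ℕ
weightSum n h = arrSum (countdown n) (h ∘ weight)

-- The index `k` is the number of cars to the left of the last one, so `suc k` becomes the divisor d
-- of the recurrence.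
weightConvolution : ℕ → (ℕ → ℕ) → ℕ
weightConvolution s h =
  ∑< (suc s) (λ k → (s C k) * weightSum k (λ p → weightSum (s ∸ k) (λ q → h (suc k * (p * q)))))

-- Only the relative order of the cars matters.
arrSum-weight : ∀ N (S : List (Fin n)) → Decreasing S → length S ≤ N → (h : ℕ → ℕ) →
  arrSum S (h ∘ weight) ≡ weightSum (length S) h

-- The cars on either side of `m` form a shorter decreasing list, of which only the length matters
-- by `arrSum-weight`. These lists are sublists and not tails, hence the bound `N` on which the
-- mutual recursion descends.
arrSum-weight-convolution : ∀ N {m : Fin n} (S : List (Fin n)) → Decreasing (m ∷ S) → length S ≤ N →
  (h : ℕ → ℕ) → arrSum (m ∷ S) (h ∘ weight) ≡ weightConvolution (length S) h

arrSum-weight N       []      _  _         h = refl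
arrSum-weight (suc N) (m ∷ S) S> (s≤s |S|≤N) h = trans (arrSum-weight-convolution N S S> |S|≤N h) (sym canonical)
  where
  canonical : weightSum (suc (length S)) h ≡ weightConvolution (length S) h
  -- The length equation leaves only the nonempty case, which exposes the head required by the
  -- convolution lemma.
  canonical with countdown (suc (length S)) | countdown-decreasing (suc (length S)) | length-countdown (suc (length S))
  ... | m′ ∷ S′ | S′> | |S′|≡|S| = trans
    (arrSum-weight-convolution N S′ S′> (subst (_≤ N) (sym (suc-injective |S′|≡|S|)) |S|≤N) h)
    (cong (λ s → weightConvolution s h) (suc-injective |S′|≡|S|))

arrSum-weight-convolution N S S>@(_ ∷ S>′) |S|≤N h = begin
  arrSum (_ ∷ S) (h ∘ weight) ≡⟨ arrSum-weight-∷ S S> h ⟩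
  splitSum S (λ A B → arrSum A (λ u → arrSum B (λ v → h (suc (length A) * (weight u * weight v)))))
    ≡⟨ splitSum-cong S (λ A B A⊆S B⊆S |A|+|B|≡|S| → trans
         (arrSum-cong A (λ u _ → arrSum-weight N B (AllPairs-resp-⊆ B⊆S S>′)
           (≤-trans (m+n≤o⇒n≤o (length A) (≤-reflexive |A|+|B|≡|S|)) |S|≤N) (λ q → h (suc (length A) * (weight u * q)))))
         (arrSum-weight N A (AllPairs-resp-⊆ A⊆S S>′)
           (≤-trans (m+n≤o⇒m≤o (length A) (≤-reflexive |A|+|B|≡|S|)) |S|≤N)
           (λ p → weightSum (length B) (λ q → h (suc (length A) * (p * q)))))) ⟩
  splitSum S (λ A B → weightSum (length A) (λ p → weightSum (length B) (λ q → h (suc (length A) * (p * q)))))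
    ≡⟨ splitSum-length S (λ a b → weightSum a (λ p → weightSum b (λ q → h (suc a * (p * q))))) ⟩
  weightConvolution (length S) h ∎

weightSum-suc : ∀ s (h : ℕ → ℕ) → weightSum (suc s) h ≡ weightConvolution s h
weightSum-suc s h with countdown (suc s) | countdown-decreasing (suc s) | length-countdown (suc s)
... | m ∷ S | S> | |S|≡1+s = trans
  (arrSum-weight-convolution (length S) S S> ≤-refl h)
  (cong (λ t → weightConvolution t h) (suc-injective |S|≡1+s))

-- All weights lie between 1 and `n !`, so agreement on this range is enough. The bounds are not
-- proved on their own; they travel through the recursion with the functions.
weightSum-cong : ∀ N n → n ≤ N → {h h′ : ℕ → ℕ} →
  (∀ p → 1 ≤ p → p ≤ n ! → h p ≡ h′ p) → weightSum n h ≡ weightSum n h′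
weightSum-cong N       zero    _         h≗h′ = h≗h′ 1 ≤-refl ≤-refl
weightSum-cong (suc N) (suc s) (s≤s s≤N) {h} {h′} h≗h′ = begin
  weightSum (suc s) h    ≡⟨ weightSum-suc s h ⟩
  weightConvolution s h  ≡⟨ ∑<-cong (suc s) (λ k k≤s → cong ((s C k) *_) (term k (≤-pred k≤s))) ⟩
  weightConvolution s h′ ≡⟨ weightSum-suc s h′ ⟨
  weightSum (suc s) h′   ∎
  where
  term : ∀ k → k ≤ s →
    weightSum k (λ p → weightSum (s ∸ k) (λ q → h (suc k * (p * q)))) ≡
    weightSum k (λ p → weightSum (s ∸ k) (λ q → h′ (suc k * (p * q))))
  term k k≤s =
    weightSum-cong N k (≤-trans k≤s s≤N) λ p 1≤p p≤k! →
    weightSum-cong N (s ∸ k) (≤-trans (m∸n≤m s k) s≤N) λ q 1≤q q≤[s∸k]! →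
    h≗h′ (suc k * (p * q)) (*-mono-≤ (s≤s (z≤n {k})) (*-mono-≤ 1≤p 1≤q))
      -- Since `k ! * (s ∸ k) !` divides `s !`, the whole product is at most `suc s * s !`.
      (*-mono-≤ (s≤s k≤s) (≤-trans (*-mono-≤ p≤k! q≤[s∸k]!) (∣⇒≤ {{s !≢0}} (k![n∸k]!∣n! k≤s))))

weightSum-*ˡ : ∀ n a (f : ℕ → ℕ) → weightSum n (λ p → a * f p) ≡ a * weightSum n f
weightSum-*ˡ n a f = arrSum-*ˡ (countdown n) a (f ∘ weight)

weightSum-zero : ∀ n → weightSum n (λ _ → 0) ≡ 0
weightSum-zero n = arrSum-0 (countdown n)

weightSum-ext : ∀ n {f g : ℕ → ℕ} → (∀ p → f p ≡ g p) → weightSum n f ≡ weightSum n g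
weightSum-ext n f≗g = arrSum-cong (countdown n) (λ w _ → f≗g (weight w))

-- Counting outcomes by weight, and divisor sums

weightCount : ℕ → ℕ → ℕ
weightCount n i = weightSum n (λ p → indicator (p ≟ i))

∑∣-indicator : ∀ m (f : (d : ℕ) .{{_ : NonZero d}} → ℕ) →
  ∑∣ m f ≡ ∑< m (λ k → indicator (suc k ∣? m) * f (suc k))
∑∣-indicator m f = trans (∑-filter (λ k → suc k ∣? m) (λ k → f (suc k)) (upTo m)) (∑-upTo m _)

-- At most one term of the sum survives, the one with `suc e = p`. It is out of range only if
-- `p > m`, and then `p` cannot divide the positive number `m`. Divisors are numbered from 1, whence
-- `1 ≤ p`.
indicator-*-≟ : ∀ p q m .{{_ : NonZero m}} → 1 ≤ p →
  indicator (p * q ≟ m) ≡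
  ∑< m (λ e → indicator (suc e ∣? m) * (indicator (p ≟ suc e) * indicator (q ≟ m / suc e)))
indicator-*-≟ (suc p) q m _ with p <? m
... | no p≮m = trans
  (indicator-no (λ pq≡m → p≮m (∣⇒≤ (subst (suc p ∣_) pq≡m (m∣m*n q)))) (suc p * q ≟ m))
  (sym (∑<-zero m λ e e<m → trans
    (cong (λ t → indicator (suc e ∣? m) * (t * indicator (q ≟ m / suc e)))
      (indicator-no (λ { refl → p≮m e<m }) (suc p ≟ suc e)))
    (*-zeroʳ (indicator (suc e ∣? m)))))
... | yes p<m = sym (begin
  ∑< m (λ e → indicator (suc e ∣? m) * (indicator (suc p ≟ suc e) * indicator (q ≟ m / suc e)))
    ≡⟨ ∑<-single m p p<m (λ e e≢p → trans
         (cong (λ t → indicator (suc e ∣? m) * (t * indicator (q ≟ m / suc e)))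
           (indicator-no (λ { refl → e≢p refl }) (suc p ≟ suc e)))
         (*-zeroʳ (indicator (suc e ∣? m)))) ⟩
  indicator (suc p ∣? m) * (indicator (suc p ≟ suc p) * indicator (q ≟ m / suc p))
    ≡⟨ cong (λ t → indicator (suc p ∣? m) * (t * indicator (q ≟ m / suc p))) (indicator-yes refl (suc p ≟ suc p)) ⟩
  indicator (suc p ∣? m) * (1 * indicator (q ≟ m / suc p))
    ≡⟨ cong (indicator (suc p ∣? m) *_) (*-identityˡ _) ⟩
  indicator (suc p ∣? m) * indicator (q ≟ m / suc p)
    ≡⟨ factor (suc p ∣? m) ⟩
  indicator (suc p * q ≟ m) ∎)
  where
  factor : (d? : Dec (suc p ∣ m)) → indicator d? * indicator (q ≟ m / suc p) ≡ indicator (suc p * q ≟ m)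
  factor (yes (divides t refl)) = trans (*-identityˡ _) (indicator-⇔
    (λ q≡ → trans (*-comm (suc p) q) (cong (_* suc p) (trans q≡ (m*n/n≡m t (suc p)))))
    (λ pq≡ → trans (*-cancelʳ-≡ q t (suc p) (trans (*-comm q (suc p)) pq≡)) (sym (m*n/n≡m t (suc p))))
    (q ≟ t * suc p / suc p) (suc p * q ≟ t * suc p))
  factor (no p∤m) = sym (indicator-no (λ pq≡m → p∤m (subst (suc p ∣_) pq≡m (m∣m*n q))) (suc p * q ≟ m))

weightCount-product : ∀ a b m .{{_ : NonZero m}} →
  weightSum a (λ p → weightSum b (λ q → indicator (p * q ≟ m))) ≡
  ∑∣ m (λ j → weightCount a j * weightCount b (m / j))
weightCount-product a b m = begin
  weightSum a (λ p → weightSum b (λ q → indicator (p * q ≟ m)))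
    -- The congruence restricted to possible weights is used because it supplies `1 ≤ p`.
    ≡⟨ weightSum-cong a a ≤-refl (λ p 1≤p _ → trans
         (weightSum-ext b (λ q → indicator-*-≟ p q m 1≤p))
         (trans (arrSum-∑< (countdown b) m _) (∑<-cong m (λ e _ → trans
           (weightSum-*ˡ b (∣e e) (λ q → indicator (p ≟ suc e) * indicator (q ≟ m / suc e)))
           (cong (∣e e *_) (weightSum-*ˡ b (indicator (p ≟ suc e)) (λ q → indicator (q ≟ m / suc e)))))))) ⟩
  weightSum a (λ p → ∑< m (λ e → ∣e e * (indicator (p ≟ suc e) * weightCount b (m / suc e))))
    ≡⟨ arrSum-∑< (countdown a) m _ ⟩
  ∑< m (λ e → weightSum a (λ p → ∣e e * (indicator (p ≟ suc e) * weightCount b (m / suc e))))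
    ≡⟨ ∑<-cong m (λ e _ → trans
         (weightSum-*ˡ a (∣e e) (λ p → indicator (p ≟ suc e) * weightCount b (m / suc e)))
         (cong (∣e e *_) (trans
         (weightSum-ext a (λ p → *-comm (indicator (p ≟ suc e)) (weightCount b (m / suc e))))
         (trans (weightSum-*ˡ a (weightCount b (m / suc e)) (λ p → indicator (p ≟ suc e)))
           (*-comm (weightCount b (m / suc e)) (weightCount a (suc e))))))) ⟩
  ∑< m (λ e → ∣e e * (weightCount a (suc e) * weightCount b (m / suc e)))
    ≡⟨ ∑∣-indicator m (λ j → weightCount a j * weightCount b (m / j)) ⟨
  ∑∣ m (λ j → weightCount a j * weightCount b (m / j)) ∎
  where ∣e = λ e → indicator (suc e ∣? m)

weightCount-multiple : ∀ a b d i .{{_ : NonZero d}} .{{_ : NonZero i}} →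
  weightSum a (λ p → weightSum b (λ q → indicator (d * (p * q) ≟ i))) ≡
  indicator (d ∣? i) * ∑∣ (i / d) (λ j → weightCount a j * weightCount b (i / d / j))
weightCount-multiple a b d i with d ∣? i
... | no d∤i = trans
  (weightSum-ext a (λ p → trans
    (weightSum-ext b (λ q → indicator-no (λ dpq≡i → d∤i (subst (d ∣_) dpq≡i (m∣m*n (p * q)))) (d * (p * q) ≟ i)))
    (weightSum-zero b)))
  (weightSum-zero a)
... | yes (divides m refl) = begin
  weightSum a (λ p → weightSum b (λ q → indicator (d * (p * q) ≟ m * d)))
    ≡⟨ weightSum-ext a (λ p → weightSum-ext b (λ q → indicator-⇔
         (λ eq → *-cancelʳ-≡ (p * q) m d (trans (*-comm (p * q) d) eq))
         (λ eq → trans (*-comm d (p * q)) (cong (_* d) eq))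
         (d * (p * q) ≟ m * d) (p * q ≟ m))) ⟩
  weightSum a (λ p → weightSum b (λ q → indicator (p * q ≟ m)))
    -- Here `i` has become `m * d`, and its being nonzero makes `m` nonzero.
    ≡⟨ weightCount-product a b m {{m*n≢0⇒m≢0 m}} ⟩
  ∑∣ m (λ j → weightCount a j * weightCount b (m / j))
    ≡⟨ cong (λ t → ∑∣ t (λ j → weightCount a j * weightCount b (t / j))) (m*n/n≡m m d) ⟨
  ∑∣ (m * d / d) (λ j → weightCount a j * weightCount b (m * d / d / j))
    ≡⟨ *-identityˡ _ ⟨
  1 * ∑∣ (m * d / d) (λ j → weightCount a j * weightCount b (m * d / d / j)) ∎

∑∣-cong : ∀ m {f g : (d : ℕ) .{{_ : NonZero d}} → ℕ} → (∀ k → f (suc k) ≡ g (suc k)) → ∑∣ m f ≡ ∑∣ m g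
∑∣-cong m f≗g = ∑-cong f≗g (filter (λ k → suc k ∣? m) (upTo m))

-- Permutations as arrangements

private
  module _ {n : ℕ} where
    open DecMembership (Fin._≟_ {n}) public using (_∉?_)

-- Carrying the entries already used allows the sum over `tuples` to be taken from the first entry
-- onwards; `Unique` would constrain the head by entries not yet chosen.
Fresh : List (Fin n) → Vec (Fin n) m → Set
Fresh X []      = ⊤
Fresh X (a ∷ σ) = a ∉ X × Fresh (a ∷ X) σ

fresh? : (X : List (Fin n)) (σ : Vec (Fin n) m) → Dec (Fresh X σ)
fresh? X []      = yes tt
fresh? X (a ∷ σ) = a ∉? X ×-dec fresh? (a ∷ X) σ

Unique⇒Fresh : {X : List (Fin n)} (σ : Vec (Fin n) m) → Vec.Unique σ → VecAll.All (_∉ X) σ → Fresh X σ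
Unique⇒Fresh []      VecAllPairs.[]         VecAll.[]         = tt
Unique⇒Fresh (a ∷ σ) (a≢ VecAllPairs.∷ σ!) (a∉X VecAll.∷ σ∉X) = a∉X ,
  Unique⇒Fresh σ σ! (VecAll.map (λ { (a≢x , _) (here x≡a) → a≢x (sym x≡a)
                                  ; (_ , x∉X) (there x∈X) → x∉X x∈X }) (VecAll.zip (a≢ , σ∉X)))

Fresh⇒Unique : {X : List (Fin n)} (σ : Vec (Fin n) m) → Fresh X σ → Vec.Unique σ × VecAll.All (_∉ X) σ
Fresh⇒Unique []      _             = VecAllPairs.[] , VecAll.[]
Fresh⇒Unique (a ∷ σ) (a∉X , fresh) with Fresh⇒Unique σ fresh
... | σ! , σ∉a∷X =
  VecAll.map (λ x∉ a≡x → x∉ (here (sym a≡x))) σ∉a∷X VecAllPairs.∷ σ! ,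
  a∉X VecAll.∷ VecAll.map (_∘ there) σ∉a∷X

infix 6 _∖_
_∖_ : List (Fin n) → List (Fin n) → List (Fin n)
L ∖ X = filter (λ a → a ∉? X) L

∖-accept : {x : Fin n} {X : List (Fin n)} (L : List (Fin n)) → x ∉ X → (x ∷ L) ∖ X ≡ x ∷ L ∖ X
∖-accept L = filter-accept _ {xs = L}

∖-reject : {x : Fin n} {X : List (Fin n)} (L : List (Fin n)) → ¬ x ∉ X → (x ∷ L) ∖ X ≡ L ∖ X
∖-reject L = filter-reject _ {xs = L}

∉-∷ : {A : Set} {a x : A} {X : List A} → x ≢ a → x ∉ X → x ∉ a ∷ X
∉-∷ x≢a x∉X (here x≡a)  = x≢a x≡a
∉-∷ x≢a x∉X (there x∈X) = x∉X x∈X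

∖-∷-∉ : {a : Fin n} (L X : List (Fin n)) → a ∉ L → L ∖ (a ∷ X) ≡ L ∖ X
∖-∷-∉         []      X a∉L = refl
∖-∷-∉ {a = a} (x ∷ L) X a∉L = case x ∉? X of λ where
  (yes x∉X) → trans (∖-accept L (∉-∷ (a∉L ∘ here ∘ sym) x∉X))
                (trans (cong (x ∷_) (∖-∷-∉ L X (a∉L ∘ there))) (sym (∖-accept L x∉X)))
  (no ¬x∉X) → trans (∖-reject L (λ x∉a∷X → ¬x∉X (x∉a∷X ∘ there)))
                (trans (∖-∷-∉ L X (a∉L ∘ there)) (sym (∖-reject L ¬x∉X)))

-- Selection drops one occurrence of the chosen entry while filtering drops them all; the two agree
-- on a list without repetitions.
selectSum-∖ : (L X : List (Fin n)) → Unique L → (g : Fin n → List (Fin n) → ℕ) →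
  selectSum g (L ∖ X) ≡ ∑ L (λ a → indicator (a ∉? X) * g a (L ∖ (a ∷ X)))
selectSum-∖ []      X []        g = refl
selectSum-∖ (x ∷ L) X (x≢ ∷ L!) g = case x ∉? X of λ where
  (yes x∉X) → begin
    selectSum g ((x ∷ L) ∖ X)
      ≡⟨ cong (selectSum g) (∖-accept L x∉X) ⟩
    g x (L ∖ X) + selectSum (λ y S → g y (x ∷ S)) (L ∖ X)
      ≡⟨ cong₂ _+_
           (trans (cong (g x) (sym (trans (∖-reject L (λ x∉ → x∉ (here refl)))
                                          (∖-∷-∉ L X (λ x∈L → All.lookup x≢ x∈L refl)))))
             (trans (sym (*-identityˡ _)) (cong (_* g x ((x ∷ L) ∖ (x ∷ X))) (sym (indicator-yes x∉X (x ∉? X))))))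
           (trans (selectSum-∖ L X L! (λ y S → g y (x ∷ S)))
             (cong sum (map-cong-local (All.map (λ {a} x≢a → cong (λ S → indicator (a ∉? X) * g a S)
               (sym (∖-accept L (∉-∷ x≢a x∉X)))) x≢)))) ⟩
    ∑ (x ∷ L) (λ a → indicator (a ∉? X) * g a ((x ∷ L) ∖ (a ∷ X))) ∎
  (no ¬x∉X) → begin
    selectSum g ((x ∷ L) ∖ X)
      ≡⟨ cong (selectSum g) (∖-reject L ¬x∉X) ⟩
    selectSum g (L ∖ X)
      ≡⟨ selectSum-∖ L X L! g ⟩
    ∑ L (λ a → indicator (a ∉? X) * g a (L ∖ (a ∷ X)))
      ≡⟨ cong₂ _+_ (cong (_* g x ((x ∷ L) ∖ (x ∷ X))) (sym (indicator-no ¬x∉X (x ∉? X))))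
           (∑-cong (λ a → cong (λ S → indicator (a ∉? X) * g a S)
             (sym (∖-reject L λ x∉a∷X → ¬x∉X (x∉a∷X ∘ there)))) L) ⟩
    ∑ (x ∷ L) (λ a → indicator (a ∉? X) * g a ((x ∷ L) ∖ (a ∷ X))) ∎

-- An intermediate form between `tuples` and `arrSum`: entries are chosen from the front, as in
-- `tuples`, but out of a shrinking list. If `k` is the length of the list, all arrangements arise.
pickSum : {A : Set} → ℕ → List A → (List A → ℕ) → ℕ
pickSum zero    S f = f []
pickSum (suc k) S f = selectSum (λ y S′ → pickSum k S′ (f ∘ (y ∷_))) S

pickSum-all : {A : Set} (k : ℕ) (S : List A) → length S ≡ k → (f : List A → ℕ) → pickSum k S f ≡ arrSum S f
pickSum-all zero    []      _       f = refl
pickSum-all (suc k) (x ∷ S) |S|≡1+k f = trans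
  (selectSum-cong (x ∷ S) λ y S′ eq →
    pickSum-all k S′ (suc-injective (trans (sym eq) |S|≡1+k)) (f ∘ (y ∷_)))
  (sym (arrSum-select x S f))

∑-fresh : (k : ℕ) (X : List (Fin n)) (f : List (Fin n) → ℕ) →
  ∑ (tuples n k) (λ σ → indicator (fresh? X σ) * f (toList σ)) ≡ pickSum k (countdown n ∖ X) f
∑-fresh         zero    X f = trans (+-identityʳ (1 * f [])) (*-identityˡ (f []))
∑-fresh {n = n} (suc k) X f = begin
  ∑ (tuples n (suc k)) (λ σ → indicator (fresh? X σ) * f (toList σ))
    ≡⟨ ∑-cartesianProductWith _∷_ _ (allFin n) (tuples n k) ⟩
  ∑ (allFin n) (λ a → ∑ (tuples n k) (λ σ → indicator (fresh? X (a ∷ σ)) * f (a ∷ toList σ)))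
    ≡⟨ ∑-cong (λ a → begin
         ∑ (tuples n k) (λ σ → indicator (fresh? X (a ∷ σ)) * f (a ∷ toList σ))
           ≡⟨ ∑-cong (λ σ → trans
                (cong (_* f (a ∷ toList σ)) (indicator-× (a ∉? X) (fresh? (a ∷ X) σ)))
                (*-assoc (indicator (a ∉? X)) _ _)) (tuples n k) ⟩
         ∑ (tuples n k) (λ σ → indicator (a ∉? X) * (indicator (fresh? (a ∷ X) σ) * f (a ∷ toList σ)))
           ≡⟨ ∑-*ˡ (indicator (a ∉? X)) _ (tuples n k) ⟩
         indicator (a ∉? X) * ∑ (tuples n k) (λ σ → indicator (fresh? (a ∷ X) σ) * f (a ∷ toList σ))
           ≡⟨ cong (indicator (a ∉? X) *_) (∑-fresh k (a ∷ X) (f ∘ (a ∷_))) ⟩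
         indicator (a ∉? X) * pickSum k (countdown n ∖ (a ∷ X)) (f ∘ (a ∷_)) ∎) (allFin n) ⟩
  ∑ (allFin n) (λ a → indicator (a ∉? X) * pickSum k (countdown n ∖ (a ∷ X)) (f ∘ (a ∷_)))
    -- The order of summation is immaterial and is changed to that of `countdown`, from which the
    -- entries are selected.
    ≡⟨ sum-↭ (map⁺ _ (↭-sym (↭-reverse (allFin n)))) ⟩
  ∑ (countdown n) (λ a → indicator (a ∉? X) * pickSum k (countdown n ∖ (a ∷ X)) (f ∘ (a ∷_)))
    ≡⟨ selectSum-∖ (countdown n) X (Decreasing⇒Unique (countdown-decreasing n)) (λ y S → pickSum k S (f ∘ (y ∷_))) ⟨
  pickSum (suc k) (countdown n ∖ X) f ∎

∑-permutations : (f : List (Fin n) → ℕ) →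
  ∑ (permutations n) (f ∘ toList) ≡ arrSum (countdown n) f
∑-permutations {n} f = begin
  ∑ (permutations n) (f ∘ toList)
    ≡⟨ ∑-filter unique? (f ∘ toList) (tuples n n) ⟩
  ∑ (tuples n n) (λ σ → indicator (unique? σ) * f (toList σ))
    ≡⟨ ∑-cong (λ σ → cong (_* f (toList σ)) (indicator-⇔
         (λ σ! → Unique⇒Fresh σ σ! (VecAll.universal (λ _ ()) σ))
         (λ fresh → proj₁ (Fresh⇒Unique {X = []} σ fresh))
         (unique? σ) (fresh? [] σ))) (tuples n n) ⟩
  ∑ (tuples n n) (λ σ → indicator (fresh? [] σ) * f (toList σ))
    ≡⟨ ∑-fresh n [] f ⟩
  pickSum n (countdown n ∖ []) f
    ≡⟨ cong (λ S → pickSum n S f) (filter-all _ (All.universal (λ _ ()) (countdown n))) ⟩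
  pickSum n (countdown n) f
    ≡⟨ pickSum-all n (countdown n) (length-countdown n) f ⟩
  arrSum (countdown n) f ∎

-- The fibres of the outcome map

-- What can be seen of car x once the first k cars have arrived.
arrived : ℕ → Fin n → Maybe (Fin n)
arrived k x = if does (toℕ x <? k) then just x else nothing

arrived-< : {x : Fin n} → toℕ x < k → arrived k x ≡ just x
arrived-< {k = k} {x} x<k = cong (if_then just x else nothing) (dec-true (toℕ x <? k) x<k)

arrived-≥ : {x : Fin n} → k ≤ toℕ x → arrived k x ≡ nothing
arrived-≥ {k = k} {x} k≤x = cong (if_then just x else nothing) (dec-false (toℕ x <? k) (≤⇒≯ k≤x))

-- Forgets the cars from `k` on in any street. Applied to the final street it recovers the street
-- after the first `k` arrivals, and so reveals whether a car has missed its place.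
restrict : ℕ → Street n m → Street n m
restrict k = Vec.map (_>>= arrived k)

-- The street after the arrival of the first k cars, if the outcome is to be σ.
stage : ℕ → Vec (Fin n) m → Street n m
stage k = Vec.map (arrived k)

restrict-full : (k : ℕ) (σ : Vec (Fin n) m) → restrict k (Vec.map just σ) ≡ stage k σ
restrict-full k σ = sym (Vec.map-∘ (_>>= arrived k) just σ)

stage-full : (σ : Vec (Fin n) m) → stage n σ ≡ Vec.map just σ
stage-full σ = Vec.map-cong (λ x → arrived-< (Fin.toℕ<n x)) σ

stage-empty : (σ : Vec (Fin n) m) → stage 0 σ ≡ Vec.replicate m nothing
stage-empty σ = Vec.map-const σ nothing

restrict-stage : (k : ℕ) (σ : Vec (Fin n) m) → restrict (suc k) (stage k σ) ≡ stage k σ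
restrict-stage k σ = trans (sym (Vec.map-∘ (_>>= arrived (suc k)) (arrived k) σ)) (Vec.map-cong already σ)
  where
  already : ∀ x → (arrived k x >>= arrived (suc k)) ≡ arrived k x
  already x with toℕ x <? k
  ... | yes x<k = trans (cong (_>>= arrived (suc k)) (arrived-< x<k))
                    (trans (arrived-< (m<n⇒m<1+n x<k)) (sym (arrived-< x<k)))
  ... | no x≮k  = trans (cong (_>>= arrived (suc k)) (arrived-≥ (≮⇒≥ x≮k))) (sym (arrived-≥ (≮⇒≥ x≮k)))

map-∷-just : {A : Set} {x y : A} {s : Vec A m} (p : Maybe (Vec A m)) →
  Maybe.map (x ∷_) p ≡ just (y ∷ s) → x ≡ y × p ≡ just s
map-∷-just (just _) refl = refl , refl

-- The invariance properties of `restrict` need nothing else about driving: parked cars stay, and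
-- the new car takes a spot that was empty.
park-update : (c : Fin n) (a : Fin m) (s : Street n m) {s′ : Street n m} → park c a s ≡ just s′ →
  ∃[ i ] lookup s i ≡ nothing × s′ ≡ s [ i ]≔ just c
park-update c zero (nothing ∷ s) refl = zero , refl , refl
park-update c zero (just b ∷ s@(_ ∷ _)) eq with park c zero s in eq′
park-update c zero (just b ∷ s@(_ ∷ _)) refl | just _ with park-update c zero s eq′
... | i , empty , refl = suc i , empty , refl
park-update c (suc a) (x ∷ s) eq with park c a s in eq′
park-update c (suc a) (x ∷ s) refl | just _ with park-update c a s eq′
... | i , empty , refl = suc i , empty , refl

-- The new car is itself forgotten, and the spot that it fills was empty before, so that spot looks
-- the same.
park-restrict-≥ : (c : Fin n) (a : Fin m) (s : Street n m) {s′ : Street n m} → park c a s ≡ just s′ →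
  k ≤ toℕ c → restrict k s′ ≡ restrict k s
park-restrict-≥ {k = k} c a s p k≤c with park-update c a s p
... | i , empty , refl = begin
  restrict k (s [ i ]≔ just c)             ≡⟨ Vec.map-[]≔ (_>>= arrived k) s i ⟩
  restrict k s [ i ]≔ arrived k c          ≡⟨ cong (restrict k s [ i ]≔_) (begin
    arrived k c                 ≡⟨ arrived-≥ k≤c ⟩
    nothing                     ≡⟨ cong (_>>= arrived k) empty ⟨
    (lookup s i >>= arrived k)  ≡⟨ Vec.lookup-map i (_>>= arrived k) s ⟨
    lookup (restrict k s) i     ∎) ⟩
  restrict k s [ i ]≔ lookup (restrict k s) i  ≡⟨ Vec.[]≔-lookup (restrict k s) i ⟩
  restrict k s                             ∎

park-restrict-< : (c : Fin n) (a : Fin m) (s : Street n m) {s′ : Street n m} → park c a s ≡ just s′ →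
  toℕ c < k → restrict k s ≡ s → restrict k s′ ≡ s′
park-restrict-< {k = k} c a s p c<k fixed with park-update c a s p
... | i , _ , refl = trans (Vec.map-[]≔ (_>>= arrived k) s i) (cong₂ (_[ i ]≔_) fixed (arrived-< c<k))

Consecutive : ℕ → Vec (Fin n) r → Set
Consecutive k []       = ⊤
Consecutive k (c ∷ cs) = toℕ c ≡ k × Consecutive (suc k) cs

parkInOrder-restrict : (cs : Vec (Fin n) r) (α : Vec (Fin m) r) (s : Street n m) {t : Street n m} {j : ℕ} →
  Consecutive j cs → k ≤ j → parkInOrder (Vec.zip cs α) s ≡ just t → restrict k t ≡ restrict k s
parkInOrder-restrict []       []      s _ _ refl = refl
parkInOrder-restrict (c ∷ cs) (a ∷ α) s (refl , cs-from) k≤c eq with park c a s in p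
... | just s′ = trans (parkInOrder-restrict cs α s′ cs-from (m≤n⇒m≤1+n k≤c) eq) (park-restrict-≥ c a s p k≤c)

stage-∉ : (c : Fin n) (σ : Vec (Fin n) m) → c ∉ toList σ → stage (toℕ c) σ ≡ stage (suc (toℕ c)) σ
stage-∉ c []      c∉σ = refl
stage-∉ c (x ∷ σ) c∉σ = cong₂ _∷_ same (stage-∉ c σ (c∉σ ∘ there))
  where
  same : arrived (toℕ c) x ≡ arrived (suc (toℕ c)) x
  same with Fin.<-cmp x c
  ... | tri< x<c _ _ = trans (arrived-< x<c) (sym (arrived-< (m<n⇒m<1+n x<c)))
  ... | tri≈ _ x≡c _ = contradiction (here (sym x≡c)) c∉σ
  ... | tri> _ _ c<x = trans (arrived-≥ (<⇒≤ c<x)) (sym (arrived-≥ c<x))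

-- The preferences that suit a single car

_≟ₛ_ : DecidableEquality (Maybe (Street n m))
_≟ₛ_ = Maybe.≡-dec (Vec.≡-dec (Maybe.≡-dec Fin._≟_))

fits : (c : Fin n) (σ : Vec (Fin n) m) (a : Fin m) → ℕ
fits c σ a = indicator (park c a (stage (toℕ c) σ) ≟ₛ just (stage (suc (toℕ c)) σ))

-- When `c` arrives, exactly the smaller cars stand in their places. Hence the three cases of
-- `reach` mean: drive past an occupied spot, park in the right spot, park wrongly in the empty spot
-- of a larger car.
fits-zero : (c : Fin n) (σ : Vec (Fin n) (suc m)) → Unique (toList σ) → fits c σ zero ≡ reach c (toList σ)
fits-zero c (x ∷ σ) (x≢ ∷ σ!) with Fin.<-cmp x c
-- The street ends at an occupied spot, so the car fails to park, in accordance with `reach` being 0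
-- on the empty word.
fits-zero c (x ∷ []) _ | tri< x<c _ _ = indicator-no
  (λ eq → case trans (cong (λ h → park c zero (h ∷ [])) (sym (arrived-< x<c))) eq of λ ())
  (park c zero (stage (toℕ c) (x ∷ [])) ≟ₛ just (stage (suc (toℕ c)) (x ∷ [])))
fits-zero c (x ∷ σ@(_ ∷ _)) (_ ∷ σ!) | tri< x<c _ _ = trans
  (indicator-⇔
    (λ eq → proj₂ (map-∷-just _ (trans (sym step) eq)))
    (λ eq → trans step (trans (cong (Maybe.map (just x ∷_)) eq)
      (cong (λ h → just (h ∷ stage (suc (toℕ c)) σ)) (sym (arrived-< (m<n⇒m<1+n x<c))))))
    (park c zero (stage (toℕ c) (x ∷ σ)) ≟ₛ just (stage (suc (toℕ c)) (x ∷ σ)))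
    (park c zero (stage (toℕ c) σ) ≟ₛ just (stage (suc (toℕ c)) σ)))
  (fits-zero c σ σ!)
  where
  step : park c zero (stage (toℕ c) (x ∷ σ)) ≡ Maybe.map (just x ∷_) (park c zero (stage (toℕ c) σ))
  step = cong (λ h → park c zero (h ∷ stage (toℕ c) σ)) (arrived-< x<c)
fits-zero c (x ∷ σ) (c≢ ∷ _) | tri≈ _ refl _ = indicator-yes
  (trans (cong (λ h → park c zero (h ∷ stage (toℕ c) σ)) (arrived-≥ {x = c} ≤-refl))
    (cong just (cong₂ _∷_ (sym (arrived-< {x = c} ≤-refl)) (stage-∉ c σ λ c∈σ → All.lookup c≢ c∈σ refl))))
  (park c zero (stage (toℕ c) (c ∷ σ)) ≟ₛ just (stage (suc (toℕ c)) (c ∷ σ)))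
-- The car takes the first spot, which is still empty in the next stage of the outcome.
fits-zero c (x ∷ σ) _ | tri> _ _ c<x = indicator-no
  (λ eq → case trans (sym (arrived-≥ c<x)) (sym (Vec.∷-injectiveˡ (Maybe.just-injective
    (trans (cong (λ h → park c zero (h ∷ stage (toℕ c) σ)) (sym (arrived-≥ (<⇒≤ c<x)))) eq)))) of λ ())
  (park c zero (stage (toℕ c) (x ∷ σ)) ≟ₛ just (stage (suc (toℕ c)) (x ∷ σ)))

fits-suc : (c x : Fin n) (σ : Vec (Fin n) m) (a : Fin m) → x ≢ c → fits c (x ∷ σ) (suc a) ≡ fits c σ a
fits-suc c x σ a x≢c = indicator-⇔
  (λ eq → proj₂ (map-∷-just (park c a (stage (toℕ c) σ)) eq))
  (λ eq → trans (cong (Maybe.map (_ ∷_)) eq) (cong (λ h → just (h ∷ stage (suc (toℕ c)) σ)) same))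
  (park c (suc a) (stage (toℕ c) (x ∷ σ)) ≟ₛ just (stage (suc (toℕ c)) (x ∷ σ)))
  (park c a (stage (toℕ c) σ) ≟ₛ just (stage (suc (toℕ c)) σ))
  where
  same : arrived (toℕ c) x ≡ arrived (suc (toℕ c)) x
  same = Vec.∷-injectiveˡ (stage-∉ c (x ∷ []) λ { (here c≡x) → x≢c (sym c≡x) })

-- Cars never drive backwards, so the place of `c` is still empty after its arrival.
fits-suc-self : (c : Fin n) (σ : Vec (Fin n) m) (a : Fin m) → fits c (c ∷ σ) (suc a) ≡ 0
fits-suc-self c σ a = indicator-no
  (λ eq → case trans (sym (arrived-≥ {x = c} ≤-refl))
    (trans (proj₁ (map-∷-just (park c a (stage (toℕ c) σ)) eq)) (arrived-< {x = c} ≤-refl)) of λ ())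
  (park c (suc a) (stage (toℕ c) (c ∷ σ)) ≟ₛ just (stage (suc (toℕ c)) (c ∷ σ)))

∑-zero : {A : Set} (xs : List A) → ∑ xs (λ _ → 0) ≡ 0
∑-zero []       = refl
∑-zero (x ∷ xs) = ∑-zero xs

∑-allFin-suc : (f : Fin (suc m) → ℕ) → ∑ (allFin (suc m)) f ≡ f zero + ∑ (allFin m) (f ∘ suc)
∑-allFin-suc f = cong (λ xs → f zero + sum xs) (trans (map-tabulate suc f) (sym (map-tabulate id (f ∘ suc))))

∑-fits : (c : Fin n) (σ : Vec (Fin n) m) → Unique (toList σ) → ∑ (allFin m) (fits c σ) ≡ choices c (toList σ)
∑-fits c []      _ = refl
∑-fits {m = suc m} c (x ∷ σ) xσ!@(x≢ ∷ σ!) = trans (∑-allFin-suc (fits c (x ∷ σ)))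
  (cong₂ _+_ (fits-zero c (x ∷ σ) xσ!) (case x Fin.≟ c of λ where
    (yes refl) → trans (∑-cong (fits-suc-self c σ) (allFin m))
                   (trans (∑-zero (allFin m)) (sym (choices-∉ c (toList σ) λ c∈σ → All.lookup x≢ c∈σ refl)))
    (no x≢c)   → trans (∑-cong (λ a → fits-suc c x σ a x≢c) (allFin m)) (∑-fits c σ σ!)))

-- A car that misses its place in σ leaves no way to complete the outcome σ.
∑-outcome : (cs : Vec (Fin n) r) (σ : Vec (Fin n) m) → Unique (toList σ) → Consecutive k cs → k + r ≡ n →
  ∑ (tuples m r) (λ α → indicator (parkInOrder (Vec.zip cs α) (stage k σ) ≟ₛ just (Vec.map just σ))) ≡
  product (map (λ c → choices c (toList σ)) (toList cs))
-- With no car left, `k` equals `n`, and this stage is the full outcome.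
∑-outcome {k = k} [] σ σ! _ k+0≡n = trans (+-identityʳ _)
  (indicator-yes (cong just (trans (cong (λ j → stage j σ) (trans (sym (+-identityʳ k)) k+0≡n)) (stage-full σ)))
    (just (stage k σ) ≟ₛ just (Vec.map just σ)))
∑-outcome {r = suc r} {m = m} (c ∷ cs) σ σ! (refl , cs-from) k+r≡n = begin
  ∑ (tuples m (suc r)) (λ α → indicator (parkInOrder (Vec.zip (c ∷ cs) α) s ≟ₛ t))
    ≡⟨ ∑-cartesianProductWith _∷_ _ (allFin m) (tuples m r) ⟩
  ∑ (allFin m) (λ a → ∑ (tuples m r) (λ α → indicator ((park c a s >>= parkInOrder (Vec.zip cs α)) ≟ₛ t)))
    ≡⟨ ∑-cong (λ a → continue a (park c a s) refl) (allFin m) ⟩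
  ∑ (allFin m) (λ a → fits c σ a * rest)
    ≡⟨ ∑-*ʳ (fits c σ) rest (allFin m) ⟩
  ∑ (allFin m) (fits c σ) * rest
    ≡⟨ cong (_* rest) (∑-fits c σ σ!) ⟩
  choices c (toList σ) * rest ∎
  where
  s = stage (toℕ c) σ
  s⁺ = stage (suc (toℕ c)) σ
  t = just (Vec.map just σ)
  rest = product (map (λ c → choices c (toList σ)) (toList cs))
  continue : ∀ a p → park c a s ≡ p →
    ∑ (tuples m r) (λ α → indicator ((p >>= parkInOrder (Vec.zip cs α)) ≟ₛ t)) ≡
    indicator (p ≟ₛ just s⁺) * rest
  continue a nothing   _ = ∑-zero (tuples m r)
  continue a (just s′) p = case s′ Vec≟ s⁺ of λ where
      (yes refl) → trans (∑-outcome cs σ σ! cs-from (trans (sym (+-suc (toℕ c) r)) k+r≡n))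
                     (trans (sym (*-identityˡ rest)) (cong (_* rest) (sym (indicator-yes refl (just s⁺ ≟ₛ just s⁺)))))
      -- Forgetting the later cars would turn a final street `σ` into `s′` as well as into `s⁺`.
      (no s′≢s⁺) → trans
        (∑-cong (λ α → indicator-no
          (λ eq → s′≢s⁺ (begin
            s′                                            ≡⟨ park-restrict-< c a s p ≤-refl (restrict-stage (toℕ c) σ) ⟨
            restrict (suc (toℕ c)) s′                     ≡⟨ parkInOrder-restrict cs α s′ cs-from ≤-refl eq ⟨
            restrict (suc (toℕ c)) (Vec.map just σ)       ≡⟨ restrict-full (suc (toℕ c)) σ ⟩
            s⁺                                            ∎))
          (parkInOrder (Vec.zip cs α) s′ ≟ₛ t)) (tuples m r))
        (trans (∑-zero (tuples m r))
          (cong (_* rest) (sym (indicator-no (s′≢s⁺ ∘ Maybe.just-injective) (just s′ ≟ₛ just s⁺)))))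
    where
    _Vec≟_ = Vec.≡-dec (Maybe.≡-dec Fin._≟_)

Consecutive-tabulate : (f : Fin r → Fin n) → (∀ i → toℕ (f i) ≡ k + toℕ i) → Consecutive k (Vec.tabulate f)
Consecutive-tabulate {r = zero}          f eq = tt
Consecutive-tabulate {r = suc r} {k = k} f eq =
  trans (eq zero) (+-identityʳ k) , Consecutive-tabulate (f ∘ suc) (λ i → trans (eq (suc i)) (+-suc k (toℕ i)))

length-fibre : (σ : Vec (Fin n) n) → Unique (toList σ) →
  length (fibre σ) ≡ product (map (λ c → choices c (toList σ)) (toList (Vec.allFin n)))
length-fibre {n} σ σ! = begin
  length (fibre σ)
    ≡⟨ length-filter (_∈φ⁻¹? σ) (tuples n n) ⟩
  ∑ (tuples n n) (λ α → indicator (parkInOrder (Vec.zip (Vec.allFin n) α) (Vec.replicate n nothing) ≟ₛ just (Vec.map just σ)))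
    ≡⟨ cong (λ s → ∑ (tuples n n) (λ α → indicator (parkInOrder (Vec.zip (Vec.allFin n) α) s ≟ₛ just (Vec.map just σ))))
         (stage-empty σ) ⟨
  ∑ (tuples n n) (λ α → indicator (parkInOrder (Vec.zip (Vec.allFin n) α) (stage 0 σ) ≟ₛ just (Vec.map just σ)))
    ≡⟨ ∑-outcome (Vec.allFin n) σ σ! (Consecutive-tabulate id (λ _ → refl)) refl ⟩
  product (map (λ c → choices c (toList σ)) (toList (Vec.allFin n))) ∎

-- The coefficients and their recurrence

toList-tabulate : (f : Fin m → A) → toList (Vec.tabulate f) ≡ tabulate f
toList-tabulate {m = zero}  f = refl
toList-tabulate {m = suc m} f = cong (f zero ∷_) (toList-tabulate (f ∘ suc))

toList-Unique : {σ : Vec A m} → Vec.Unique σ → Unique (toList σ)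
toList-Unique VecAllPairs.[]         = []
toList-Unique (x≢ VecAllPairs.∷ σ!) = VecAll.toList⁺ x≢ ∷ toList-Unique σ!

c-weightSum : ∀ n (i : ℤ) → c (+ n) i ≡ weightSum n (λ p → indicator (+ p ℤ.≟ i))
c-weightSum n i = begin
  c (+ n) i
    ≡⟨ length-filter (λ σ → + length (fibre σ) ℤ.≟ i) (permutations n) ⟩
  ∑ (permutations n) (λ σ → indicator (+ length (fibre σ) ℤ.≟ i))
    ≡⟨ cong sum (map-cong-local (All.map (λ {σ} σ! →
         cong (λ l → indicator (+ l ℤ.≟ i)) (length-fibre σ (toList-Unique σ!))) (All.all-filter unique? (tuples n n)))) ⟩
  ∑ (permutations n) (λ σ → indicator (+ product (map (λ c → choices c (toList σ)) cars) ℤ.≟ i))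
    ≡⟨ ∑-permutations (λ w → indicator (+ product (map (λ c → choices c w) cars) ℤ.≟ i)) ⟩
  arrSum (countdown n) (λ w → indicator (+ product (map (λ c → choices c w) cars) ℤ.≟ i))
    -- The fibre size is a product in order of arrival and `weight` one along the word; the word is
    -- a permutation of the cars.
    ≡⟨ arrSum-cong (countdown n) (λ w w↭ → cong (λ l → indicator (+ l ℤ.≟ i))
         (product-↭ (map⁺ (λ c → choices c w) (↭-sym (↭-trans w↭ countdown↭cars))))) ⟩
  weightSum n (λ p → indicator (+ p ℤ.≟ i)) ∎
  where
  cars = toList (Vec.allFin n)
  countdown↭cars : countdown n ↭ cars
  countdown↭cars = ↭-trans (↭-reverse (allFin n)) (↭-reflexive (sym (toList-tabulate id)))

c-weightCount : ∀ n i → c (+ n) (+ i) ≡ weightCount n i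
c-weightCount n i = trans (c-weightSum n (+ i))
  (weightSum-ext n (λ p → indicator-⇔ ℤ.+-injective (cong (λ q → + q)) (+ p ℤ.≟ + i) (p ≟ i)))

-- All weights lie between 1 and `n !`, and on this range the indicator of such an `i` is zero.
c-vanishes : ∀ n i → ¬ (+ 1 ℤ.≤ i × i ℤ.≤ + (n !)) → c (+ n) i ≡ 0
c-vanishes n i out-of-range = begin
  c (+ n) i                                  ≡⟨ c-weightSum n i ⟩
  weightSum n (λ p → indicator (+ p ℤ.≟ i))  ≡⟨ weightSum-cong n n ≤-refl (λ p 1≤p p≤n! →
    indicator-no (λ { refl → out-of-range (ℤ.+≤+ 1≤p , ℤ.+≤+ p≤n!) }) (+ p ℤ.≟ i)) ⟩
  weightSum n (λ _ → 0)                      ≡⟨ weightSum-zero n ⟩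
  0                                          ∎

c-recurrence : ∀ s i .{{_ : NonZero i}} →
  c (+ suc s) (+ i) ≡
    ∑∣ i (λ d → (s C (d ∸ 1)) *
      ∑∣ (i / d) (λ j →
        c (+ d ℤ.- + 1) (+ j) * c (+ suc s ℤ.- + d) (+ (_/_ i (d * j) {{m*n≢0 d j}}))))
c-recurrence s i = begin
  c (+ suc s) (+ i)
    ≡⟨ c-weightCount (suc s) i ⟩
  weightCount (suc s) i
    ≡⟨ weightSum-suc s (λ p → indicator (p ≟ i)) ⟩
  weightConvolution s (λ p → indicator (p ≟ i))
    ≡⟨ ∑<-cong (suc s) (λ k k≤s → cong ((s C k) *_) (trans
         (weightCount-multiple k (s ∸ k) (suc k) i)
         (cong (indicator (suc k ∣? i) *_) (sym (inner-weightCount k (≤-pred k≤s)))))) ⟩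
  ∑< (suc s) term
    -- The range `k ≤ s` is exchanged for `k < i` through a common larger range: for `k > s` the
    -- binomial coefficient is 0, and for `k ≥ i` the number `suc k` is too large to divide `i`.
    ≡⟨ ∑<-extend (suc s) i (λ k s<k → cong (_* (indicator (suc k ∣? i) * inner (suc k))) (k>n⇒nCk≡0 s<k)) ⟨
  ∑< (suc s + i) term
    ≡⟨ cong (λ t → ∑< t term) (+-comm (suc s) i) ⟩
  ∑< (i + suc s) term
    ≡⟨ ∑<-extend i (suc s) (λ k i≤k → trans
         (cong (λ t → (s C k) * (t * inner (suc k))) (indicator-no (<⇒≱ (s≤s i≤k) ∘ ∣⇒≤) (suc k ∣? i)))
         (*-zeroʳ (s C k))) ⟩
  ∑< i term
    ≡⟨ ∑<-cong i (λ k _ → *-swapˡ (s C k) (indicator (suc k ∣? i)) (inner (suc k))) ⟩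
  ∑< i (λ k → indicator (suc k ∣? i) * ((s C k) * inner (suc k)))
    ≡⟨ ∑∣-indicator i (λ d → (s C (d ∸ 1)) * inner d) ⟨
  ∑∣ i (λ d → (s C (d ∸ 1)) * inner d) ∎
  where
  inner : (d : ℕ) .{{_ : NonZero d}} → ℕ
  inner d = ∑∣ (i / d) (λ j →
    c (+ d ℤ.- + 1) (+ j) * c (+ suc s ℤ.- + d) (+ (_/_ i (d * j) {{m*n≢0 d j}})))
  term : ℕ → ℕ
  term k = (s C k) * (indicator (suc k ∣? i) * inner (suc k))
  difference : ∀ k → k ≤ s → + suc s ℤ.- + suc k ≡ + (s ∸ k)
  difference k k≤s = trans (ℤ.m-n≡m⊖n (suc s) (suc k)) (ℤ.⊖-≥ (s≤s k≤s))
  inner-weightCount : ∀ k → k ≤ s →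
    inner (suc k) ≡ ∑∣ (i / suc k) (λ j → weightCount k j * weightCount (s ∸ k) (i / suc k / j))
  inner-weightCount k k≤s = ∑∣-cong (i / suc k)
    -- The index `+ suc k ℤ.- + 1` computes to `+ k`, so only the second index has to be rewritten.
    {λ j → c (+ k) (+ j) * c (+ suc s ℤ.- + suc k) (+ (_/_ i (suc k * j) {{m*n≢0 (suc k) j}}))}
    {λ j → weightCount k j * weightCount (s ∸ k) (i / suc k / j)}
    (λ e → cong₂ _*_ (c-weightCount k (suc e)) (begin
      c (+ suc s ℤ.- + suc k) (+ (i / (suc k * suc e)))
        ≡⟨ cong₂ (λ x y → c x (+ y)) (difference k k≤s) (sym (m/n/o≡m/[n*o] i (suc k) (suc e))) ⟩
      c (+ (s ∸ k)) (+ (i / suc k / suc e))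
        ≡⟨ c-weightCount (s ∸ k) (i / suc k / suc e) ⟩
      weightCount (s ∸ k) (i / suc k / suc e) ∎))

proposition4p1 : (n : ℕ) → 1 ≤ n →
    ((i : ℕ) → 1 ≤ i → i ≤ n ! →
    c (+ n) (+ i) ≡
    ∑∣ i (λ d →
    ((n ∸ 1) C (d ∸ 1)) *
    ∑∣ (i / d) (λ j →
    c (+ d ℤ.- + 1) (+ j) *
    c (+ n ℤ.- + d) (+ (_/_ i (d * j) {{m*n≢0 d j}})))))
    × ((i : ℤ) → ¬ (+ 1 ℤ.≤ i × i ℤ.≤ + (n !)) → c (+ n) i ≡ 0)
proposition4p1 n@(suc s) _ = (λ i 1≤i _ → c-recurrence s i {{>-nonZero 1≤i}}) , c-vanishes n
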